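{- Let $\lambda$ be a partition. For a cell $(i,j)\in\lambda$ let $$w(i,j)=\max\{\,i'-i+j'-j : (i',j')\in\lambda,\ i\le i',\ j\le j'\,\}.$$ Then the worst case complexity $W(\lambda)$ of the Novelli--Pak--Stoyanovskii algorithm on $\lambda$ satisfies $$W(\lambda)=\sum_{(i,j)\in\lambda} w(i,j).$$
   Context: A partition $\lambda$ of $n$ is a weakly decreasing sequence $\lambda_1\ge\dots\ge\lambda_k>0$ of positive integers with sum $|\lambda|=n$; its length is $l(\lambda)=k$. It is identified with its Young diagram $\{(i,j):1\le i\le l(\lambda),\ 1\le j\le\lambda_i\}$, whose elements are called cells ($i$ is the row, $j$ the column). A cell $(i,j)$ is a corner of $\lambda$ if neither $(i+1,j)$ nor $(i,j+1)$ belongs to $\lambda$ (i.e. it has hook length $1$). A tableau of shape $\lambda$ is a bijection $T:\lambda\to\{1,\dots,n\}$; the set of tableaux is $\mathrm{T}(\lambda)$. The (column-wise) Novelli--Pak--Stoyanovskii (NPS) algorithm applied to $T\in \mathrm{T}(\lambda)$: order cells by $(i,j)\preceq(i',j')$ if $j<j'$, or $j=j'$ and $i\le i'$. Let $(i_1,j_1)\succ(i_2,j_2)\succ\dots\succ(i_n,j_n)$ be the cells of $\lambda$ in decreasing order, put $k_r=T(i_r,j_r)$ (entries of the initial tableau $T$) and $T_0=T$. For $r=1,\dots,n$ the tableau $T_r$ is obtained from $T_{r-1}$ as follows. Start with the current tableau equal to $T_{r-1}$ and repeat: let $(i,j)$ be the cell of the current tableau containing $k_r$. If $(i,j)$ is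 a corner of $\lambda$, stop. Otherwise let $m$ be the minimum of the entries of the current tableau in the cells of $\lambda\cap\{(i+1,j),(i,j+1)\}$. If $k_r<m$, stop. If $m<k_r$, exchange the entries $m$ and $k_r$ (this counts as one exchange) and repeat. When stopped, $T_r$ is the current tableau. $n(T)$ denotes the total number of exchanges performed during the construction of $T_1,\dots,T_n$. The worst case complexity is $W(\lambda)=\max_{T\in \mathrm{T}(\lambda)}n(T)$. -}

module Defs where

open import Data.Fin.Base using (Fin; _<_)
open import Data.Fin.Permutation using (transpose)
open import Data.Fin.Properties using (≤-totalOrder; <⇒≢; _≟_; _<?_)
open import Data.List.Base
  using (List; []; _∷_; map; filter; concatMap; mapMaybe; catMaybes; upTo; reverse; foldl; length)
import Data.List.Extrema as Extrema
import Data.List.Extrema.Nat as ℕExtrema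
open import Data.List.Membership.Propositional using (_∈_)
open import Data.List.Membership.Propositional.Properties using (∈-map⁻)
open import Data.List.Relation.Unary.All using (All; []; _∷_)
open import Data.List.Relation.Unary.Any using (here; there)
open import Data.List.Relation.Unary.Linked using (Linked; []; [-]; _∷_)
open import Data.Maybe.Base as Maybe using (Maybe; just; nothing)
open import Data.Nat.Base as ℕ using (ℕ; zero; suc; _+_; _∸_)
open import Data.Nat.ListAction using (sum)
import Data.Nat.Properties as ℕ
open import Data.Product.Base using (∃-syntax; _×_; _,_; proj₂)
open import Data.Sum.Base using (inj₁; inj₂)
open import Function.Bundles using (_↔_; module Inverse)
open import Function.Construct.Composition using (_↔-∘_)
open import Relation.Binary.PropositionalEquality
  using (_≡_; refl; sym; trans; cong; subst)
open import Relation.Nullary using (Dec; yes; no; contradiction)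
open import Relation.Nullary.Decidable using (_×-dec_; dec⇒maybe)

record Partition : Set where
  field
    parts      : List ℕ
    decreasing : Linked ℕ._≥_ parts
    positive   : All (0 ℕ.<_) parts

open Partition public

∣_∣ : Partition → ℕ
∣ Λ ∣ = sum (parts Λ)

-- Rows and columns are numbered from 0, and a row beyond the last one has
-- length 0; thus (i , j) is a cell exactly when j < part i.

part : List ℕ → ℕ → ℕ
part []       _       = 0
part (x ∷ xs) zero    = x
part (x ∷ xs) (suc i) = part xs i

record Cell (Λ : Partition) : Set where
  constructor cell
  field
    row    : ℕ
    col    : ℕ
    inside : col ℕ.< part (parts Λ) row

open Cell public

cell? : (Λ : Partition) → ℕ → ℕ → Maybe (Cell Λ)
cell? Λ i j = Maybe.map (cell i j) (dec⇒maybe (j ℕ.<? part (parts Λ) i))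

-- All cells, in increasing order for ≼: column by column from left to right,
-- each column from top to bottom.

cells : (Λ : Partition) → List (Cell Λ)
cells Λ = concatMap (λ j → mapMaybe (λ i → cell? Λ i j) (upTo (length (parts Λ))))
                    (upTo (part (parts Λ) 0))

-- The list is empty exactly when the given cell is a corner.

neighbours : ∀ {Λ} → Cell Λ → List (Cell Λ)
neighbours {Λ} c = catMaybes (cell? Λ (suc (row c)) (col c) ∷ cell? Λ (row c) (suc (col c)) ∷ [])

-- Entries are 0, …, n - 1 rather than 1, …, n; only their relative order matters.

Tableau : Partition → Set
Tableau Λ = Cell Λ ↔ Fin ∣ Λ ∣

entry : ∀ {Λ} → Tableau Λ → Cell Λ → Fin ∣ Λ ∣
entry = Inverse.to

locate : ∀ {Λ} → Tableau Λ → Fin ∣ Λ ∣ → Cell Λ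
locate = Inverse.from

exchange : ∀ {Λ} → Fin ∣ Λ ∣ → Fin ∣ Λ ∣ → Tableau Λ → Tableau Λ
exchange k m T = transpose k m ↔-∘ T

-- The entry with which k is to be exchanged next: the minimum m of the
-- neighbouring entries, provided that there are any and that m < k.

module _ {Λ : Partition} where

  open Extrema (≤-totalOrder ∣ Λ ∣) using (min; argmin-sel)

  ifSmaller : Fin ∣ Λ ∣ → List (Fin ∣ Λ ∣) → Maybe (Fin ∣ Λ ∣)
  ifSmaller k []       = nothing
  ifSmaller k (e ∷ es) with min e es <? k
  ... | yes _ = just (min e es)
  ... | no  _ = nothing

  partner : Tableau Λ → Fin ∣ Λ ∣ → Maybe (Fin ∣ Λ ∣)
  partner T k = ifSmaller k (map (entry T) (neighbours (locate T k)))

  -- Facts needed only for the termination of `sift`.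

  ifSmaller-just : ∀ k es {m} → ifSmaller k es ≡ just m → m ∈ es × m < k
  ifSmaller-just k (e ∷ es) eq with min e es <? k
  ifSmaller-just k (e ∷ es) refl | yes m<k with argmin-sel (λ x → x) e es
  ... | inj₁ m≡e  = here m≡e , m<k
  ... | inj₂ m∈es = there m∈es , m<k

  distance : Cell Λ → ℕ
  distance c = row c + col c

  neighbours-distance : ∀ (c : Cell Λ) {d} → d ∈ neighbours c → distance d ≡ suc (distance c)
  neighbours-distance c d∈
    with col c ℕ.<? part (parts Λ) (suc (row c))
       | suc (col c) ℕ.<? part (parts Λ) (row c)
  neighbours-distance c (here refl)         | yes _ | yes _ = refl
  neighbours-distance c (there (here refl)) | yes _ | yes _ = ℕ.+-suc (row c) (col c)
  neighbours-distance c (here refl)         | yes _ | no _  = refl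
  neighbours-distance c (here refl)         | no _  | yes _ = ℕ.+-suc (row c) (col c)

  locate-exchange : ∀ (T : Tableau Λ) k m → m < k → locate (exchange {Λ} k m T) k ≡ locate T m
  locate-exchange T k m m<k with k ≟ m
  ... | yes refl = contradiction refl (<⇒≢ m<k)
  ... | no  _ with k ≟ k
  ...   | yes _   = refl
  ...   | no  k≢k = contradiction refl k≢k

  exchange-distance : ∀ (T : Tableau Λ) k {m} → partner T k ≡ just m →
                      distance (locate (exchange {Λ} k m T) k) ≡ suc (distance (locate T k))
  exchange-distance T k {m} eq
    with ifSmaller-just k (map (entry T) (neighbours (locate T k))) eq
  ... | m∈ , m<k with ∈-map⁻ (entry T) m∈
  ...   | d , d∈ , m≡Td =
    trans (cong distance (trans (locate-exchange T k m m<k) (Inverse.inverseʳ T m≡Td)))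
          (neighbours-distance (locate T k) d∈)

distance<size : ∀ xs → All (0 ℕ.<_) xs → ∀ i j → j ℕ.< part xs i → i + j ℕ.< sum xs
distance<size (x ∷ xs) (_  ∷ _)   zero    j j<x = ℕ.<-≤-trans j<x (ℕ.m≤m+n x (sum xs))
distance<size (x ∷ xs) (0<x ∷ ps) (suc i) j j<  =
  ℕ.+-mono-≤ 0<x (distance<size xs ps i j j<)

-- Moves the entry k until it stops; returns the final tableau and the number
-- of exchanges.  Since an exchange increases row + column of the cell holding
-- k by one, and this is always below ∣ Λ ∣, the bound `b` never cuts the
-- procedure short: the hypothesis rules out an exchange when b is exhausted.

sift : ∀ {Λ} (b : ℕ) (T : Tableau Λ) (k : Fin ∣ Λ ∣) →
       ∣ Λ ∣ ℕ.≤ b + distance (locate T k) → Tableau Λ × ℕ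
sift {Λ} b T k enough with partner {Λ} T k in eq
... | nothing = T , 0
sift {Λ} zero T k enough | just m =
  contradiction (distance<size (parts Λ) (positive Λ) _ _ (inside (locate T k)))
                (ℕ.≤⇒≯ enough)
sift {Λ} (suc b) T k enough | just m =
  let T′ , e = sift {Λ} b (exchange {Λ} k m T) k
                 (subst (∣ Λ ∣ ℕ.≤_)
                        (sym (trans (cong (b +_) (exchange-distance T k eq)) (ℕ.+-suc b _)))
                        enough)
  in T′ , suc e

-- One round T_{r-1} ↦ T_r, accumulating the number of exchanges.

nps-round : ∀ {Λ} → Tableau Λ × ℕ → Fin ∣ Λ ∣ → Tableau Λ × ℕ
nps-round {Λ} (T , e) k =
  let T′ , e′ = sift {Λ} ∣ Λ ∣ T k (ℕ.m≤m+n ∣ Λ ∣ _)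
  in T′ , e + e′

-- The entries k_r are read off the initial tableau.

nps : ∀ {Λ} → Tableau Λ → Tableau Λ × ℕ
nps {Λ} T = foldl (nps-round {Λ}) (T , 0) (map (entry T) (reverse (cells Λ)))

exchanges : ∀ {Λ} → Tableau Λ → ℕ
exchanges {Λ} T = proj₂ (nps {Λ} T)

-- W = max { exchanges T : T a tableau of shape Λ }

IsWorstCaseComplexity : Partition → ℕ → Set
IsWorstCaseComplexity Λ W =
  (∃[ T ] exchanges {Λ} T ≡ W) × (∀ (T : Tableau Λ) → exchanges {Λ} T ℕ.≤ W)

_≤ᶜ?_ : ∀ {Λ} (c d : Cell Λ) → Dec (row c ℕ.≤ row d × col c ℕ.≤ col d)
c ≤ᶜ? d = (row c ℕ.≤? row d) ×-dec (col c ℕ.≤? col d)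

-- The set maximised over contains 0 (take (i′ , j′) = (i , j)), so the
-- default value 0 is harmless.

w : ∀ {Λ} → Cell Λ → ℕ
w {Λ} c = ℕExtrema.max 0
  (map (λ d → (row d ∸ row c) + (col d ∸ col c)) (filter (c ≤ᶜ?_) (cells Λ)))

{-# OPTIONS --safe #-}
module Submission where

-- Call the reach of a cell c the largest distance (row + column) of a cell weakly
-- below and to the right of c; it is distance c + w c.  An exchange moves the
-- sifted entry one step further from the origin, which gives the upper bound.
-- For equality, fill the diagram so that cells of larger reach hold smaller
-- entries and, among cells of equal reach, those processed earlier hold smaller
-- ones.  Then every exchange stays within cells of one reach: as long as its
-- distance is below the reach, the sifted entry has a neighbour of the same
-- reach, holding a smaller entry, and the least neighbour is such a one.  So
-- the entry stops only when its distance equals the reach.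

open import Defs
open import Data.Fin.Base as Fin using (Fin; toℕ)
open import Data.Fin.Permutation.Components using (transpose)
import Data.Fin.Properties as Fin
open import Data.List.Base
  using (List; []; _∷_; _++_; map; filter; mapMaybe; foldl; upTo; length; tabulate; lookup; reverse)
import Data.List.Extrema as Extrema
import Data.List.Extrema.Nat as ℕExtrema
open import Data.List.Membership.Propositional using (_∈_; lose)
open import Data.List.Membership.Propositional.Properties
  using (∈-map⁺; ∈-map⁻; ∈-filter⁺; ∈-filter⁻; ∈-concatMap⁺; ∈-tabulate⁺; ∈-tabulate⁻;
         ∈-++⁺ˡ; ∈-++⁺ʳ; ∈-++⁻; ∈-lookup; ∈-upTo⁺)
open import Data.List.Properties using (length-++; length-tabulate; unfold-reverse)
open import Data.List.Relation.Binary.Permutation.Propositional using (↭-sym; ↭⇒↭ₛ)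
open import Data.List.Relation.Binary.Permutation.Propositional.Properties
  using (↭-length; ↭-reverse; ∈-resp-↭; map⁺)
import Data.List.Relation.Binary.Permutation.Setoid.Properties as Permutationₛ
open import Data.List.Relation.Unary.All as All using (All; []; _∷_)
import Data.List.Relation.Unary.All.Properties as All
open import Data.List.Relation.Unary.AllPairs as AllPairs using (AllPairs; []; _∷_)
import Data.List.Relation.Unary.AllPairs.Properties as AllPairs
open import Data.List.Relation.Unary.Any using (here; there; index)
open import Data.List.Relation.Unary.Any.Properties using (lookup-index; mapMaybe⁺)
import Data.List.Relation.Unary.Any.Properties as Any
open import Data.List.Relation.Unary.Linked using (Linked; []; _∷_; [-])
open import Data.List.Relation.Unary.Sorted.TotalOrder.Properties using (lookup-mono-≤)
open import Data.List.Relation.Unary.Unique.Propositional using (Unique)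
import Data.List.Relation.Unary.Unique.Propositional.Properties as Unique
import Data.List.Sort as Sort
open import Data.Maybe.Base using (Maybe; just; nothing)
import Data.Maybe.Relation.Unary.All as Maybe
import Data.Maybe.Relation.Unary.Any as MaybeAny
open import Data.Nat.Base as ℕ using (ℕ; zero; suc; _+_; _∸_)
open import Data.Nat.ListAction using (sum)
open import Data.Nat.ListAction.Properties using (sum-↭)
import Data.Nat.Properties as ℕ
open import Data.Product.Base using (∃; ∃-syntax; _×_; _,_; proj₁; proj₂)
open import Data.Product.Relation.Binary.Lex.Strict using (×-strictTotalOrder)
open import Data.Sum.Base using (_⊎_; inj₁; inj₂)
open import Data.Unit.Base using (⊤; tt)
open import Function.Base using (_∘_; flip; id)
open import Function.Bundles using (_↔_; module Inverse; mk↔ₛ′)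
open import Level using (0ℓ)
open import Relation.Binary.Bundles using (StrictTotalOrder; DecTotalOrder)
import Relation.Binary.Construct.Flip.EqAndOrd as Flip
import Relation.Binary.Construct.On as On
import Relation.Binary.Properties.StrictTotalOrder as StrictTotal
open import Relation.Binary.PropositionalEquality
  using (_≡_; _≢_; refl; sym; trans; cong; cong₂; subst; subst₂; setoid; module ≡-Reasoning)
open import Relation.Nullary using (¬_; Dec; yes; no; contradiction)
open import Algebra.Properties.CommutativeSemigroup ℕ.+-commutativeSemigroup using (interchange)

-- Transpositions and auxiliary facts on lists.

transpose-left : ∀ {n} (i j : Fin n) → transpose i j i ≡ j
transpose-left i j with i Fin.≟ i
... | yes _   = refl
... | no  i≢i = contradiction refl i≢i

transpose-right : ∀ {n} (i j : Fin n) → transpose i j j ≡ i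
transpose-right i j with j Fin.≟ i
... | yes j≡i = j≡i
... | no  _ with j Fin.≟ j
...   | yes _   = refl
...   | no  j≢j = contradiction refl j≢j

transpose-other : ∀ {n} (i j : Fin n) {k} → k ≢ i → k ≢ j → transpose i j k ≡ k
transpose-other i j {k} k≢i k≢j with k Fin.≟ i
... | yes k≡i = contradiction k≡i k≢i
... | no  _ with k Fin.≟ j
...   | yes k≡j = contradiction k≡j k≢j
...   | no  _   = refl

lookup-injective : ∀ {A : Set} {xs : List A} → Unique xs → ∀ i j → lookup xs i ≡ lookup xs j → i ≡ j
lookup-injective (_ ∷ _)    Fin.zero    Fin.zero    _  = refl
lookup-injective (x∉ ∷ _)   Fin.zero    (Fin.suc j) eq = contradiction eq (All.lookup x∉ (∈-lookup j))
lookup-injective (x∉ ∷ _)   (Fin.suc i) Fin.zero    eq = contradiction (sym eq) (All.lookup x∉ (∈-lookup i))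
lookup-injective (_ ∷ uniq) (Fin.suc i) (Fin.suc j) eq = cong Fin.suc (lookup-injective uniq i j eq)

AllPairs-reverse : ∀ {A : Set} {R : A → A → Set} {xs} → AllPairs R xs → AllPairs (flip R) (reverse xs)
AllPairs-reverse []                       = []
AllPairs-reverse {xs = x ∷ xs} (x~ ∷ pxs) = subst (AllPairs _) (sym (unfold-reverse x xs))
  (AllPairs.++⁺ (AllPairs-reverse pxs) ([] ∷ [])
    (All.tabulate (λ y∈ → All.lookup x~ (∈-resp-↭ (↭-reverse xs) y∈) ∷ [])))

AllPairs-mapMaybe : ∀ {A B : Set} {R : A → A → Set} {S : B → B → Set} (f : A → Maybe B) →
  (∀ {x y a b} → R x y → f x ≡ just a → f y ≡ just b → S a b) →
  ∀ {xs} → AllPairs R xs → AllPairs S (mapMaybe f xs)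
AllPairs-mapMaybe f pres []                      = []
AllPairs-mapMaybe f pres {x ∷ xs} (x~ ∷ pxs) with f x in fx
... | nothing = AllPairs-mapMaybe f pres pxs
... | just a  = All.mapMaybe⁺ (All.map⁺ (All.map related x~)) ∷ AllPairs-mapMaybe f pres pxs
  where
  related : ∀ {y} → _ → Maybe.All _ (f y)
  related {y} x~y with f y in fy
  ... | nothing = Maybe.nothing
  ... | just b  = Maybe.just (pres x~y fx fy)

-- Ranking a finite type by a key.

module _ {A : Set} {n : ℕ} (O : StrictTotalOrder 0ℓ 0ℓ 0ℓ) (key : A → StrictTotalOrder.Carrier O)
         (xs : List A) (size : length xs ≡ n) (uniq : Unique xs) (complete : ∀ a → a ∈ xs) where

  private
    module O = StrictTotalOrder O
    D : DecTotalOrder 0ℓ 0ℓ 0ℓ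
    D = On.decTotalOrder (StrictTotal.decTotalOrder O) key
    open Sort D using (sort; sort-↭; sort-↗)

    -- Stated for an arbitrary monotone list `ys`, so that its length equation can be matched with
    -- `refl` and positions in `ys` become elements of `Fin n`. If positions failed to increase
    -- strictly, monotonicity would reverse the given strict inequality of keys.
    ranked : ∀ ys → length ys ≡ n → Unique ys → (∀ a → a ∈ ys) →
             (∀ {i j} → i Fin.≤ j → let k = key (lookup ys i); l = key (lookup ys j) in k O.< l ⊎ k O.≈ l) →
             ∃ λ (f : A ↔ Fin n) → ∀ {a b} → key a O.< key b → Inverse.to f a Fin.< Inverse.to f b
    ranked ys refl uniq complete mono =
      mk↔ₛ′ (index ∘ complete) (lookup ys)
            (λ i → lookup-injective uniq _ _ (sym (lookup-index (complete (lookup ys i)))))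
            (λ a → sym (lookup-index (complete a))) ,
      increasing
      where
      increasing : ∀ {a b} → key a O.< key b → index (complete a) Fin.< index (complete b)
      increasing {a} {b} a<b with index (complete a) Fin.<? index (complete b)
      ... | yes ia<ib = ia<ib
      ... | no  ia≮ib with mono (ℕ.≮⇒≥ ia≮ib)
      ...   | inj₁ b<a rewrite sym (lookup-index (complete a)) | sym (lookup-index (complete b)) =
        contradiction a<b (O.asym b<a)
      ...   | inj₂ b≈a rewrite sym (lookup-index (complete a)) | sym (lookup-index (complete b)) =
        contradiction a<b (O.irrefl (O.Eq.sym b≈a))

  -- The rank of an element is its position in the list sorted by `key`.
  rank : ∃ λ (f : A ↔ Fin n) → ∀ {a b} → key a O.< key b → Inverse.to f a Fin.< Inverse.to f b
  rank = ranked (sort xs) (trans (↭-length (sort-↭ xs)) size)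
    (Permutationₛ.Unique-resp-↭ (setoid A) (↭⇒↭ₛ (↭-sym (sort-↭ xs))) uniq)
    (λ a → ∈-resp-↭ (↭-sym (sort-↭ xs)) (complete a))
    (lookup-mono-≤ (DecTotalOrder.totalOrder D) (sort-↗ xs))

-- Enumerating the diagram row by row.

-- Going by rows follows the recursion of `sum`, so the number of cells comes out as the sum of the
-- parts; the column-wise list `cells` does not follow that recursion.
enumerate : ∀ {A : Set} xs → (∀ i j → j ℕ.< part xs i → A) → List A
enumerate []       f = []
enumerate (x ∷ xs) f = tabulate {n = x} (λ j → f 0 (toℕ j) (Fin.toℕ<n j)) ++ enumerate xs (f ∘ suc)

length-enumerate : ∀ {A : Set} xs (f : ∀ i j → j ℕ.< part xs i → A) → length (enumerate xs f) ≡ sum xs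
length-enumerate []       f = refl
length-enumerate (x ∷ xs) f = trans (length-++ (tabulate (λ j → f 0 (toℕ j) (Fin.toℕ<n j))))
  (cong₂ _+_ (length-tabulate (λ j → f 0 (toℕ j) (Fin.toℕ<n j))) (length-enumerate xs (f ∘ suc)))

∈-enumerate⁺ : ∀ {A : Set} xs (f : ∀ i j → j ℕ.< part xs i → A) i j (j< : j ℕ.< part xs i) →
               f i j j< ∈ enumerate xs f
∈-enumerate⁺ (x ∷ xs) f zero    j j< =
  subst (_∈ enumerate (x ∷ xs) f) (at (Fin.toℕ-fromℕ< j<) (Fin.toℕ<n k)) (∈-++⁺ˡ (∈-tabulate⁺ k))
  where
  k = Fin.fromℕ< j<

  at : ∀ {j′} → j′ ≡ j → ∀ j′< → f 0 j′ j′< ≡ f 0 j j<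
  at refl j′< = cong (f 0 j) (ℕ.<-irrelevant j′< j<)
∈-enumerate⁺ (x ∷ xs) f (suc i) j j< = ∈-++⁺ʳ _ (∈-enumerate⁺ xs (f ∘ suc) i j j<)

∈-enumerate⁻ : ∀ {A : Set} xs (f : ∀ i j → j ℕ.< part xs i → A) {a} → a ∈ enumerate xs f →
               ∃[ i ] ∃[ j ] ∃[ j< ] a ≡ f i j j<
∈-enumerate⁻ (x ∷ xs) f a∈ with ∈-++⁻ (tabulate (λ j → f 0 (toℕ j) (Fin.toℕ<n j))) a∈
... | inj₁ a∈row with ∈-tabulate⁻ a∈row
...   | j , eq = 0 , toℕ j , Fin.toℕ<n j , eq
∈-enumerate⁻ (x ∷ xs) f a∈ | inj₂ a∈rest with ∈-enumerate⁻ xs (f ∘ suc) a∈rest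
...   | i , j , j< , eq = suc i , j , j< , eq

enumerate-unique : ∀ {A : Set} xs (f : ∀ i j → j ℕ.< part xs i → A) →
                   (∀ {i j j< i′ j′ j′<} → f i j j< ≡ f i′ j′ j′< → i ≡ i′ × j ≡ j′) → Unique (enumerate xs f)
enumerate-unique []       f inj = []
enumerate-unique (x ∷ xs) f inj = Unique.++⁺
  (Unique.tabulate⁺ (λ eq → Fin.toℕ-injective (proj₂ (inj eq))))
  (enumerate-unique xs (f ∘ suc) (λ eq → ℕ.suc-injective (proj₁ (inj eq)) , proj₂ (inj eq)))
  disjoint
  where
  disjoint : ∀ {a} → ¬ (a ∈ tabulate (λ j → f 0 (toℕ j) (Fin.toℕ<n j)) × a ∈ enumerate xs (f ∘ suc))
  disjoint (a∈row , a∈rest) with ∈-tabulate⁻ a∈row | ∈-enumerate⁻ xs (f ∘ suc) a∈rest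
  ... | _ , a≡ | _ , _ , _ , a≡′ with proj₁ (inj (trans (sym a≡) a≡′))
  ...   | ()

-- The shape of the diagram and two orders on its cells.

part-antitone : ∀ {xs} → Linked ℕ._≥_ xs → ∀ {i i′} → i ℕ.≤ i′ → part xs i′ ℕ.≤ part xs i
part-antitone []          _                             = ℕ.z≤n
part-antitone [-]         {i′ = zero}  ℕ.z≤n            = ℕ.≤-refl
part-antitone [-]         {i′ = suc _} _                = ℕ.z≤n
part-antitone (_ ∷ _)     {i′ = zero}  ℕ.z≤n            = ℕ.≤-refl
part-antitone (x≥y ∷ xs↘) {zero}  {suc i} _             = ℕ.≤-trans (part-antitone xs↘ {zero} {i} ℕ.z≤n) x≥y
part-antitone (_ ∷ xs↘)   {suc _} {suc _} (ℕ.s≤s i≤i′) = part-antitone xs↘ i≤i′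

row<length : ∀ xs {i j} → j ℕ.< part xs i → i ℕ.< length xs
row<length (x ∷ xs) {zero}  _  = ℕ.z<s
row<length (x ∷ xs) {suc i} j< = ℕ.s<s (row<length xs j<)

module _ {Λ : Partition} where

  open Extrema (Fin.≤-totalOrder ∣ Λ ∣) using (min; min≤⊤; min≤xs)

  infix 4 _⊑_ _≺_

  _⊑_ : Cell Λ → Cell Λ → Set
  c ⊑ d = row c ℕ.≤ row d × col c ℕ.≤ col d

  ⊑-refl : ∀ c → c ⊑ c
  ⊑-refl _ = ℕ.≤-refl , ℕ.≤-refl

  ⊑-trans : ∀ c d e → c ⊑ d → d ⊑ e → c ⊑ e
  ⊑-trans _ _ _ (r , s) (r′ , s′) = ℕ.≤-trans r r′ , ℕ.≤-trans s s′

  -- Written so that it unfolds to the strict lexicographic order on pairs of column and row; rounds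
  -- process cells from the `≺`-largest to the `≺`-smallest.
  _≺_ : Cell Λ → Cell Λ → Set
  c ≺ d = col c ℕ.< col d ⊎ (col c ≡ col d × row c ℕ.< row d)

  -- This keeps a run that starts at `d` away from the cells still waiting to be processed.
  ≺⇒⋣ : ∀ c d → c ≺ d → ¬ d ⊑ c
  ≺⇒⋣ _ _ (inj₁ c<d)        (_ , d≤c) = ℕ.<⇒≱ c<d d≤c
  ≺⇒⋣ _ _ (inj₂ (_ , r<r′)) (d≤c , _) = ℕ.<⇒≱ r<r′ d≤c

  cell-injective : ∀ {i j j< i′ j′ j′<} → cell {Λ} i j j< ≡ cell i′ j′ j′< → i ≡ i′ × j ≡ j′
  cell-injective refl = refl , refl

  cell-cong : ∀ {c d : Cell Λ} → row c ≡ row d → col c ≡ col d → c ≡ d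
  cell-cong {cell i j p} {cell _ _ q} refl refl = cong (cell i j) (ℕ.<-irrelevant p q)

  cell?-just : ∀ i j {c} → cell? Λ i j ≡ just c → row c ≡ i × col c ≡ j
  cell?-just i j eq with j ℕ.<? part (parts Λ) i
  cell?-just i j refl | yes _ = refl , refl

  cell?-complete : (c : Cell Λ) → MaybeAny.Any (c ≡_) (cell? Λ (row c) (col c))
  cell?-complete c with col c ℕ.<? part (parts Λ) (row c)
  ... | yes _ = MaybeAny.just (cell-cong refl refl)
  ... | no c≮ = contradiction (inside c) c≮

  ∈-cells : ∀ c → c ∈ cells Λ
  ∈-cells c = ∈-concatMap⁺ _
    (lose (∈-upTo⁺ (ℕ.<-≤-trans (inside c) (part-antitone (decreasing Λ) {0} {row c} ℕ.z≤n)))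
      (mapMaybe⁺ (λ i → cell? Λ i (col c)) (upTo (length (parts Λ)))
        (Any.map⁺ (lose (∈-upTo⁺ (row<length (parts Λ) (inside c))) (cell?-complete c)))))

  cells-increasing : AllPairs _≺_ (cells Λ)
  cells-increasing = AllPairs.concat⁺
    (All.map⁺ (All.universal increasing (upTo (part (parts Λ) 0))))
    (AllPairs.map⁺ (AllPairs.applyUpTo⁺₁ id _ (λ j<j′ _ →
      All.map (λ c≡j → All.map (λ d≡j′ → inj₁ (subst₂ ℕ._<_ (sym c≡j) (sym d≡j′) j<j′)) (in-column _)) (in-column _))))
    where
    column : ℕ → List (Cell Λ)
    column j = mapMaybe (λ i → cell? Λ i j) (upTo (length (parts Λ)))

    in-column : ∀ j → All (λ c → col c ≡ j) (column j)
    in-column j = All.mapMaybe⁺ (All.map⁺ (All.universal (λ i → found i) (upTo (length (parts Λ)))))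
      where
      found : ∀ i → Maybe.All (λ c → col c ≡ j) (cell? Λ i j)
      found i with cell? Λ i j in eq
      ... | nothing = Maybe.nothing
      ... | just c  = Maybe.just (proj₂ (cell?-just i j eq))

    increasing : ∀ j → AllPairs _≺_ (column j)
    increasing j = AllPairs-mapMaybe (λ i → cell? Λ i j) step
      (AllPairs.applyUpTo⁺₁ id (length (parts Λ)) (λ i<i′ _ → i<i′))
      where
      step : ∀ {i i′ c d} → i ℕ.< i′ → cell? Λ i j ≡ just c → cell? Λ i′ j ≡ just d → c ≺ d
      step {i} {i′} i<i′ eq eq′ with cell?-just i j eq | cell?-just i′ j eq′
      ... | refl , refl | refl , col≡ = inj₂ (sym col≡ , i<i′)

  neighbours-⊒ : ∀ (c : Cell Λ) {d} → d ∈ neighbours c → c ⊑ d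
  neighbours-⊒ c d∈
    with col c ℕ.<? part (parts Λ) (suc (row c))
       | suc (col c) ℕ.<? part (parts Λ) (row c)
  neighbours-⊒ c (here refl)         | yes _ | yes _ = ℕ.n≤1+n _ , ℕ.≤-refl
  neighbours-⊒ c (there (here refl)) | yes _ | yes _ = ℕ.≤-refl , ℕ.n≤1+n _
  neighbours-⊒ c (here refl)         | yes _ | no _  = ℕ.n≤1+n _ , ℕ.≤-refl
  neighbours-⊒ c (here refl)         | no _  | yes _ = ℕ.≤-refl , ℕ.n≤1+n _

  neighbour-distinct : ∀ (c : Cell Λ) {d} → d ∈ neighbours c → d ≢ c
  neighbour-distinct c d∈ refl = ℕ.1+n≢n {distance c} (sym (neighbours-distance c d∈))

  below∈neighbours : ∀ (c : Cell Λ) p → cell (suc (row c)) (col c) p ∈ neighbours c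
  below∈neighbours c p
    with col c ℕ.<? part (parts Λ) (suc (row c))
  ... | yes _ = here (cell-cong refl refl)
  ... | no ¬p = contradiction p ¬p

  right∈neighbours : ∀ (c : Cell Λ) p → cell (row c) (suc (col c)) p ∈ neighbours c
  right∈neighbours c p
    with col c ℕ.<? part (parts Λ) (suc (row c))
       | suc (col c) ℕ.<? part (parts Λ) (row c)
  ... | yes _ | yes _ = there (here (cell-cong refl refl))
  ... | no _  | yes _ = here (cell-cong refl refl)
  ... | _     | no ¬p = contradiction p ¬p

  -- Some coordinate of `c` is still below that of `e`, since otherwise the distances would compare
  -- the other way. Increasing it stays weakly northwest of `e`, hence inside the diagram because
  -- row lengths decrease.
  neighbour-towards : ∀ c e → c ⊑ e → distance c ℕ.< distance e → ∃[ d ] d ∈ neighbours c × d ⊑ e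
  neighbour-towards c e (r≤ , s≤) c<e with row c ℕ.<? row e
  ... | yes r< = _ , below∈neighbours c
                       (ℕ.<-≤-trans (ℕ.≤-<-trans s≤ (inside e)) (part-antitone (decreasing Λ) r<)) , r< , s≤
  ... | no r≮ with col c ℕ.<? col e
  ...   | yes s< = _ , right∈neighbours c
                       (ℕ.<-≤-trans (ℕ.≤-<-trans s< (inside e)) (part-antitone (decreasing Λ) r≤)) , r≤ , s<
  ...   | no s≮ = contradiction c<e (ℕ.≤⇒≯ (ℕ.+-mono-≤ (ℕ.≮⇒≥ r≮) (ℕ.≮⇒≥ s≮)))

  distance-split : ∀ (c d : Cell Λ) → c ⊑ d → distance c + ((row d ∸ row c) + (col d ∸ col c)) ≡ distance d
  distance-split c d (r , s) =
    trans (interchange (row c) (col c) (row d ∸ row c) (col d ∸ col c)) (cong₂ _+_ (ℕ.m+[n∸m]≡n r) (ℕ.m+[n∸m]≡n s))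

  -- The reach of a cell.

  opaque
    -- Opaque, so that later goals do not unfold to a maximum over a list; outside the block `reach`
    -- is known through `reach-w` and the two extremal properties.
    reach : Cell Λ → ℕ
    reach c = distance c + w c

    reach-w : ∀ c → reach c ≡ distance c + w c
    reach-w c = refl

    distance≤reach : ∀ c d → c ⊑ d → distance d ℕ.≤ reach c
    distance≤reach c d c⊑d = subst (ℕ._≤ reach c) (distance-split c d c⊑d) (ℕ.+-monoʳ-≤ (distance c)
      (All.lookup (ℕExtrema.xs≤max 0 _) (∈-map⁺ _ (∈-filter⁺ (c ≤ᶜ?_) (∈-cells d) c⊑d))))

    reach-attained : ∀ c → ∃[ d ] c ⊑ d × distance d ≡ reach c
    reach-attained c with ℕExtrema.argmax-sel id 0
      (map (λ d → (row d ∸ row c) + (col d ∸ col c)) (filter (c ≤ᶜ?_) (cells Λ)))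
    -- The maximum is its default value 0, so `c` itself attains its reach.
    ... | inj₁ w≡0 = c , ⊑-refl c , sym (trans (cong (distance c +_) w≡0) (ℕ.+-identityʳ _))
    ... | inj₂ w∈ with ∈-map⁻ _ w∈
    ...   | d , d∈ , w≡ with ∈-filter⁻ (c ≤ᶜ?_) {xs = cells Λ} d∈
    ...     | _ , c⊑d = d , c⊑d , trans (sym (distance-split c d c⊑d)) (cong (distance c +_) (sym w≡))

  -- A cell attaining the reach of `d` is also weakly southeast of `c`.
  reach-antitone : ∀ c d → c ⊑ d → reach d ℕ.≤ reach c
  reach-antitone c d c⊑d with reach-attained d
  ... | e , d⊑e , eq = subst (ℕ._≤ reach c) eq (distance≤reach c e (⊑-trans c d e c⊑d d⊑e))

  -- A step towards a cell attaining the reach of `c` keeps that cell weakly southeast.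
  neighbour-same-reach : ∀ c → distance c ℕ.< reach c → ∃[ d ] d ∈ neighbours c × reach d ≡ reach c
  neighbour-same-reach c c< with reach-attained c
  ... | e , c⊑e , eq with neighbour-towards c e c⊑e (subst (distance c ℕ.<_) (sym eq) c<)
  ...   | d , d∈ , d⊑e = d , d∈ ,
    ℕ.≤-antisym (reach-antitone c d (neighbours-⊒ c d∈)) (subst (ℕ._≤ reach d) eq (distance≤reach d e d⊑e))

  -- The entry chosen for an exchange.

  ifSmaller-least : ∀ k es {m} → ifSmaller {Λ} k es ≡ just m → All (m Fin.≤_) es
  ifSmaller-least k (e ∷ es) eq with min e es Fin.<? k
  ifSmaller-least k (e ∷ es) refl | yes _ = min≤⊤ e es ∷ min≤xs e es

  ifSmaller-nothing : ∀ k es → ifSmaller {Λ} k es ≡ nothing → All (k Fin.≤_) es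
  ifSmaller-nothing k []       eq = []
  ifSmaller-nothing k (e ∷ es) eq with min e es Fin.<? k
  ... | no m≮k = ℕ.≤-trans (ℕ.≮⇒≥ m≮k) (min≤⊤ e es) ∷ All.map (ℕ.≤-trans (ℕ.≮⇒≥ m≮k)) (min≤xs e es)

  locate-entry : ∀ (T : Tableau Λ) {k p} → entry T p ≡ k → locate T k ≡ p
  locate-entry T eq = Inverse.inverseʳ T (sym eq)

  entry-locate : ∀ (T : Tableau Λ) k → entry T (locate T k) ≡ k
  entry-locate T k = Inverse.inverseˡ T refl

  partner-just : ∀ (T : Tableau Λ) k {m} → partner {Λ} T k ≡ just m →
    m Fin.< k × locate T m ∈ neighbours (locate T k) × (∀ {d} → d ∈ neighbours (locate T k) → m Fin.≤ entry T d)
  partner-just T k eq with ifSmaller-just k (map (entry T) (neighbours (locate T k))) eq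
  ... | m∈ , m<k with ∈-map⁻ (entry T) m∈
  ...   | d , d∈ , m≡Td = m<k , subst (_∈ _) (sym (locate-entry T (sym m≡Td))) d∈ ,
    λ d′∈ → All.lookup (ifSmaller-least k _ eq) (∈-map⁺ (entry T) d′∈)

  partner-nothing : ∀ (T : Tableau Λ) k → partner {Λ} T k ≡ nothing →
    ∀ {d} → d ∈ neighbours (locate T k) → k Fin.≤ entry T d
  partner-nothing T k eq d∈ = All.lookup (ifSmaller-nothing k _ eq) (∈-map⁺ (entry T) d∈)

  exchange-other : ∀ (T : Tableau Λ) k m {p} → p ≢ locate T k → p ≢ locate T m →
                   entry (exchange {Λ} k m T) p ≡ entry T p
  exchange-other T k m p≢k p≢m =
    transpose-other k m (p≢k ∘ sym ∘ locate-entry T) (p≢m ∘ sym ∘ locate-entry T)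

  -- Runs: the exchanges of a single round.

  -- The graph of `sift` freed of its bound and termination proof, which allows induction on the
  -- exchanges themselves.
  data Run (k : Fin ∣ Λ ∣) : Tableau Λ → Tableau Λ → ℕ → Set where
    stop : ∀ {T} → partner {Λ} T k ≡ nothing → Run k T T 0
    step : ∀ {T T′ m e} → partner {Λ} T k ≡ just m →
           Run k (exchange {Λ} k m T) T′ e → Run k T T′ (suc e)

  -- `sift` branches on `partner T k` while also using an equation for it, so
  -- abstracting `partner T k` in a goal about `sift` would rewrite both sides of
  -- that equation.  Two copies u and v of the unit, equal by η but syntactically
  -- distinct, keep the left-hand side out of the abstraction.

  partner-refl : (T : ⊤ → Tableau Λ) (u v : ⊤) → ∀ k → partner {Λ} (T v) k ≡ partner {Λ} (T u) k
  partner-refl T u v k = refl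

  sift-run : ∀ b (T : ⊤ → Tableau Λ) (u v : ⊤) k enough → let T′ , e = sift {Λ} b (T u) k enough in Run k (T u) T′ e
  sift-run b T u v k enough with partner {Λ} (T u) k | partner-refl T u v k
  ... | nothing | eq = stop eq
  sift-run zero T u v k enough | just m | eq =
    contradiction (distance<size (parts Λ) (positive Λ) _ _ (inside (locate (T u) k))) (ℕ.≤⇒≯ enough)
  sift-run (suc b) T u v k enough | just m | eq = step eq (sift-run b (λ _ → _) u v k _)

  round-run : ∀ (T : Tableau Λ) k → let T′ , e = sift {Λ} ∣ Λ ∣ T k (ℕ.m≤m+n ∣ Λ ∣ _) in Run k T T′ e
  round-run T k = sift-run ∣ Λ ∣ (λ _ → T) tt tt k _

  -- Each exchange raises the distance of the cell holding `k` by one and cannot raise its reach,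
  -- and a distance never exceeds the reach of its cell.
  run-bounded : ∀ {k T T′ e} → Run k T T′ e → e + distance (locate T k) ℕ.≤ reach (locate T k)
  run-bounded {k} {T} (stop _) = distance≤reach (locate T k) (locate T k) (⊑-refl (locate T k))
  run-bounded {k} {T} (step {m = m} {e} eq run) with partner-just T k eq
  ... | m<k , d∈ , _ = begin
    suc e + distance c              ≡⟨ ℕ.+-suc e (distance c) ⟨
    e + suc (distance c)            ≡⟨ cong (e +_) (neighbours-distance c d∈) ⟨
    e + distance d                  ≡⟨ cong (λ c′ → e + distance c′) (locate-exchange T k m m<k) ⟨
    e + distance (locate T₁ k)      ≤⟨ run-bounded run ⟩
    reach (locate T₁ k)             ≡⟨ cong reach (locate-exchange T k m m<k) ⟩
    reach d                         ≤⟨ reach-antitone c d (neighbours-⊒ c d∈) ⟩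
    reach c                         ∎
    where
    open ℕ.≤-Reasoning
    c = locate T k
    d = locate T m
    T₁ = exchange {Λ} k m T

  -- The sifted entry visits only cells weakly southeast of its start, and exchanges alter visited
  -- cells only.
  run-frame : ∀ {k T T′ e} → Run k T T′ e → ∀ p → ¬ locate T k ⊑ p → entry T′ p ≡ entry T p
  run-frame (stop _) p c⋢p = refl
  run-frame {k} {T} (step {m = m} eq run) p c⋢p with partner-just T k eq
  ... | m<k , d∈ , _ = trans
    (run-frame run p (λ d⊑p → d⋢p (subst (_⊑ p) (locate-exchange T k m m<k) d⊑p)))
    (exchange-other T k m (λ { refl → c⋢p (⊑-refl p) }) (λ { refl → d⋢p (⊑-refl p) }))
    where
    d⋢p : ¬ locate T m ⊑ p
    d⋢p d⊑p = c⋢p (⊑-trans (locate T k) (locate T m) p (neighbours-⊒ (locate T k) d∈) d⊑p)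

  -- Runs that go as far as the reach allows.

  module _ (κ : Fin ∣ Λ ∣ → ℕ) (κ-anti : ∀ {a b} → κ b ℕ.< κ a → a Fin.< b) where

    -- In the application `κ` gives the reach of the cell that an entry occupies initially, so
    -- grading says that entries have moved only among cells of equal reach.
    Graded : Tableau Λ → Set
    Graded T = ∀ p → κ (entry T p) ≡ reach p

    exchange-graded : ∀ T k m → reach (locate T m) ≡ reach (locate T k) → Graded T → Graded (exchange {Λ} k m T)
    exchange-graded T k m eq graded p = graded′ (entry T p Fin.≟ k) (entry T p Fin.≟ m)
      where
      open ≡-Reasoning
      graded′ : Dec (entry T p ≡ k) → Dec (entry T p ≡ m) → κ (transpose k m (entry T p)) ≡ reach p
      graded′ (no p≢k)  (no p≢m)  = trans (cong κ (transpose-other k m p≢k p≢m)) (graded p)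
      graded′ (yes p≡k) _         = begin
        κ (transpose k m (entry T p)) ≡⟨ cong (κ ∘ transpose k m) p≡k ⟩
        κ (transpose k m k)           ≡⟨ cong κ (transpose-left k m) ⟩
        κ m                           ≡⟨ cong κ (entry-locate T m) ⟨
        κ (entry T (locate T m))      ≡⟨ graded (locate T m) ⟩
        reach (locate T m)            ≡⟨ eq ⟩
        reach (locate T k)            ≡⟨ cong reach (locate-entry T p≡k) ⟩
        reach p                       ∎
      graded′ (no _)    (yes p≡m) = begin
        κ (transpose k m (entry T p)) ≡⟨ cong (κ ∘ transpose k m) p≡m ⟩
        κ (transpose k m m)           ≡⟨ cong κ (transpose-right k m) ⟩
        κ k                           ≡⟨ cong κ (entry-locate T k) ⟨
        κ (entry T (locate T k))      ≡⟨ graded (locate T k) ⟩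
        reach (locate T k)            ≡⟨ eq ⟨
        reach (locate T m)            ≡⟨ cong reach (locate-entry T p≡m) ⟩
        reach p                       ∎

    -- This prevents an early stop: a neighbour of the same reach, if there is one, holds an entry
    -- smaller than `k`.
    Dominates : Fin ∣ Λ ∣ → Tableau Λ → Set
    Dominates k T = ∀ p → locate T k ⊑ p → p ≢ locate T k → reach p ≡ reach (locate T k) → entry T p Fin.< k

    -- Stopping at a distance below the reach would leave a neighbour of the same reach with an
    -- entry not below `k`, against dominance. An exchange preserves the reach, the grading and
    -- dominance, so induction applies.
    run-exact : ∀ {k T T′ e} → Run k T T′ e → Graded T → Dominates k T →
                e + distance (locate T k) ≡ reach (locate T k) × Graded T′
    run-exact {k} {T} (stop eq) graded dom with distance (locate T k) ℕ.<? reach (locate T k)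
    ... | no  c≮ = ℕ.≤-antisym (distance≤reach (locate T k) (locate T k) (⊑-refl (locate T k))) (ℕ.≮⇒≥ c≮) , graded
    ... | yes c< with neighbour-same-reach (locate T k) c<
    ...   | d , d∈ , rd≡rc = contradiction
      (dom d (neighbours-⊒ (locate T k) d∈) (neighbour-distinct (locate T k) d∈) rd≡rc) (ℕ.≤⇒≯ (partner-nothing T k eq d∈))
    run-exact {k} {T} {T′} (step {m = m} {e} eq run) graded dom with partner-just T k eq
    ... | m<k , d∈ , m-least = exact , proj₂ later
      where
      c = locate T k
      d = locate T m
      T₁ = exchange {Λ} k m T

      c⊑d : c ⊑ d
      c⊑d = neighbours-⊒ c d∈

      distance-c<d : distance c ℕ.< distance d
      distance-c<d = ℕ.≤-reflexive (sym (neighbours-distance c d∈))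

      -- Entries are smaller where the reach is larger, so the least neighbour
      -- has the largest reach.
      same-reach : reach d ≡ reach c
      same-reach with neighbour-same-reach c
                        (ℕ.<-≤-trans distance-c<d (distance≤reach c d c⊑d))
      ... | d′ , d′∈ , rd′≡rc = ℕ.≤-antisym (reach-antitone c d c⊑d) (ℕ.≮⇒≥ λ rd<rc →
        ℕ.<⇒≱ (κ-anti (subst₂ ℕ._<_ (trans (sym (graded d)) (cong κ (entry-locate T m)))
                                     (trans (sym rd′≡rc) (sym (graded d′))) rd<rc))
              (m-least d′∈))

      at-d : locate T₁ k ≡ d
      at-d = locate-exchange T k m m<k

      -- Cells weakly southeast of `d` are so of `c` too, and apart from `d` the exchange leaves
      -- them alone. Such a cell is not `c`, whose distance is smaller than that of `d`.
      dominates : Dominates k T₁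
      dominates p d⊑p p≢d rp≡rd = subst (Fin._< k) (sym (exchange-other T k m p≢c p≢d′))
        (dom p c⊑p p≢c (trans rp≡rd (trans (cong reach at-d) same-reach)))
        where
        p≢d′ : p ≢ d
        p≢d′ p≡d = p≢d (trans p≡d (sym at-d))
        c⊑p : c ⊑ p
        c⊑p = ⊑-trans c d p c⊑d (subst (_⊑ p) at-d d⊑p)
        p≢c : p ≢ c
        p≢c refl = ℕ.<⇒≱ distance-c<d (ℕ.+-mono-≤ (proj₁ d⊑c) (proj₂ d⊑c))
          where
          d⊑c : d ⊑ c
          d⊑c = subst (_⊑ c) at-d d⊑p

      later : e + distance (locate T₁ k) ≡ reach (locate T₁ k) × Graded T′
      later = run-exact run (exchange-graded T k m same-reach graded) dominates

      exact : suc e + distance c ≡ reach c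
      exact = begin
        suc e + distance c         ≡⟨ ℕ.+-suc e (distance c) ⟨
        e + suc (distance c)       ≡⟨ cong (e +_) (neighbours-distance c d∈) ⟨
        e + distance d             ≡⟨ cong (λ c′ → e + distance c′) at-d ⟨
        e + distance (locate T₁ k) ≡⟨ proj₁ later ⟩
        reach (locate T₁ k)        ≡⟨ cong reach at-d ⟩
        reach d                    ≡⟨ same-reach ⟩
        reach c                    ∎
        where open ≡-Reasoning

  -- The sequence of rounds.

  module _ (T₀ : Tableau Λ) where

    -- Cells yet to be processed keep their initial entries; hence the entry read off `T₀` at `u` is
    -- still at `u` when its round begins.
    Untouched : List (Cell Λ) → Tableau Λ → Set
    Untouched us T = All (λ p → entry T p ≡ entry T₀ p) us

    round-frame : ∀ {u us T T′ e} → All (_≺ u) us → Untouched (u ∷ us) T → Run (entry T₀ u) T T′ e → Untouched us T′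
    round-frame {u} {T = T} us≺u (Tu ∷ Tus) run = All.zipWith
      (λ {p} → λ { (p≺u , Tp) →
        trans (run-frame run p (λ c⊑p → ≺⇒⋣ p u p≺u (subst (_⊑ p) (locate-entry T Tu) c⊑p))) Tp })
      (us≺u , Tus)

    -- The round of `u` starts at `u`, so cancelling `distance u` in the bound on its run leaves at
    -- most `w u` exchanges.
    rounds-bounded : ∀ us T e → AllPairs (flip _≺_) us → Untouched us T →
      proj₂ (foldl (nps-round {Λ}) (T , e) (map (entry T₀) us)) ℕ.≤ e + sum (map w us)
    rounds-bounded []       T e _              _            = ℕ.≤-reflexive (sym (ℕ.+-identityʳ e))
    rounds-bounded (u ∷ us) T e (us≺u ∷ us↘) untouched@(Tu ∷ _) = begin
      proj₂ (foldl (nps-round {Λ}) (T′ , e + e′) (map (entry T₀) us))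
        ≤⟨ rounds-bounded us T′ (e + e′) us↘ (round-frame us≺u untouched run) ⟩
      e + e′ + sum (map w us)
        ≤⟨ ℕ.+-monoˡ-≤ (sum (map w us)) (ℕ.+-monoʳ-≤ e e′≤w) ⟩
      e + w u + sum (map w us)
        ≡⟨ ℕ.+-assoc e (w u) _ ⟩
      e + (w u + sum (map w us))
        ∎
      where
      open ℕ.≤-Reasoning
      k = entry T₀ u
      T′ = proj₁ (sift {Λ} ∣ Λ ∣ T k (ℕ.m≤m+n ∣ Λ ∣ _))
      e′ = proj₂ (sift {Λ} ∣ Λ ∣ T k (ℕ.m≤m+n ∣ Λ ∣ _))

      run : Run k T T′ e′
      run = round-run T k

      e′≤w : e′ ℕ.≤ w u
      e′≤w = ℕ.+-cancelˡ-≤ (distance u) e′ (w u)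
        (subst₂ ℕ._≤_ (ℕ.+-comm e′ (distance u)) (reach-w u)
          (subst (λ c → e′ + distance c ℕ.≤ reach c) (locate-entry T Tu) (run-bounded run)))

    module _ (reach-first : ∀ {c d} → reach d ℕ.< reach c → entry T₀ c Fin.< entry T₀ d)
             (late-first : ∀ {c d} → reach c ≡ reach d → c ≺ d → entry T₀ d Fin.< entry T₀ c) where

      grade : Fin ∣ Λ ∣ → ℕ
      grade = reach ∘ locate T₀

      grade-anti : ∀ {a b} → grade b ℕ.< grade a → a Fin.< b
      grade-anti {a} {b} b<a = subst₂ Fin._<_ (entry-locate T₀ a) (entry-locate T₀ b) (reach-first b<a)

      -- Besides the untouched cells, the induction carries the grading and the fact that each cell
      -- either awaits its round or comes after all those waiting. Together with `late-first` they
      -- give the dominance that makes each round cost exactly `w u`.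
      rounds-exact : ∀ us T e → AllPairs (flip _≺_) us → Untouched us T →
        (∀ p → p ∈ us ⊎ All (_≺ p) us) → Graded grade grade-anti T →
        proj₂ (foldl (nps-round {Λ}) (T , e) (map (entry T₀) us)) ≡ e + sum (map w us)
      rounds-exact []       T e _              _         _       _      = sym (ℕ.+-identityʳ e)
      rounds-exact (u ∷ us) T e (us≺u ∷ us↘) untouched@(Tu ∷ Tus) covered graded = begin
        proj₂ (foldl (nps-round {Λ}) (T′ , e + e′) (map (entry T₀) us))
          ≡⟨ rounds-exact us T′ (e + e′) us↘ (round-frame us≺u untouched run) covered′ (proj₂ exact) ⟩
        e + e′ + sum (map w us)
          ≡⟨ cong (λ x → e + x + sum (map w us)) e′≡w ⟩
        e + w u + sum (map w us)
          ≡⟨ ℕ.+-assoc e (w u) _ ⟩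
        e + (w u + sum (map w us))
          ∎
        where
        open ≡-Reasoning
        k = entry T₀ u
        T′ = proj₁ (sift {Λ} ∣ Λ ∣ T k (ℕ.m≤m+n ∣ Λ ∣ _))
        e′ = proj₂ (sift {Λ} ∣ Λ ∣ T k (ℕ.m≤m+n ∣ Λ ∣ _))

        run : Run k T T′ e′
        run = round-run T k

        at-u : locate T k ≡ u
        at-u = locate-entry T Tu

        covered′ : ∀ p → p ∈ us ⊎ All (_≺ p) us
        covered′ p with covered p
        ... | inj₁ (here refl)     = inj₂ us≺u
        ... | inj₁ (there p∈us)    = inj₁ p∈us
        ... | inj₂ (_ ∷ us≺p)      = inj₂ us≺p

        dominates : ∀ p → u ⊑ p → p ≢ u → reach p ≡ reach u → entry T p Fin.< k
        dominates p u⊑p p≢u rp≡ru = subst (Fin._< k) Tq≡ (q-before (covered q))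
          where
          -- The initial cell of the entry now at `p`. If it were `u` or still waiting, the entry
          -- would not have moved, so `p` would be `u` or precede it, both excluded. Hence `q` has
          -- been processed; by the grading it has the reach of `u`, and `late-first` applies.
          q = locate T₀ (entry T p)

          Tq≡ : entry T₀ q ≡ entry T p
          Tq≡ = entry-locate T₀ (entry T p)

          same : ∀ {c} → entry T c ≡ entry T₀ c → q ≡ c → p ≡ c
          same Tc refl = trans (sym (locate-entry T refl)) (locate-entry T (trans Tc Tq≡))

          q-before : q ∈ u ∷ us ⊎ All (_≺ q) (u ∷ us) → entry T₀ q Fin.< k
          q-before (inj₁ (here q≡u))   = contradiction (same Tu q≡u) p≢u
          q-before (inj₁ (there q∈us)) = contradiction u⊑p
            (≺⇒⋣ p u (subst (_≺ u) (sym (same (All.lookup Tus q∈us) refl)) (All.lookup us≺u q∈us)))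
          q-before (inj₂ (u≺q ∷ _))    = late-first (trans (sym rp≡ru) (sym (graded p))) u≺q

        exact : e′ + distance (locate T k) ≡ reach (locate T k) × Graded grade grade-anti T′
        exact = run-exact grade grade-anti run graded
          (subst (λ c → ∀ p → c ⊑ p → p ≢ c → reach p ≡ reach c → entry T p Fin.< k) (sym at-u) dominates)

        e′≡w : e′ ≡ w u
        e′≡w = ℕ.+-cancelˡ-≡ (distance u) e′ (w u)
          (trans (ℕ.+-comm (distance u) e′)
            (trans (subst (λ c → e′ + distance c ≡ reach c) at-u (proj₁ exact)) (reach-w u)))

  -- A tableau attaining the bound.

  cells-decreasing : AllPairs (flip _≺_) (reverse (cells Λ))
  cells-decreasing = AllPairs-reverse cells-increasing

  sum-w-reverse : sum (map w (reverse (cells Λ))) ≡ sum (map w (cells Λ))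
  sum-w-reverse = sum-↭ (map⁺ w (↭-reverse (cells Λ)))

  -- The order is reversed because larger keys are to receive smaller entries: larger reach first
  -- and, within one reach, later columns and lower rows first.
  ℕ³-descending : StrictTotalOrder 0ℓ 0ℓ 0ℓ
  ℕ³-descending = Flip.strictTotalOrder
    (×-strictTotalOrder ℕ.<-strictTotalOrder (×-strictTotalOrder ℕ.<-strictTotalOrder ℕ.<-strictTotalOrder))

  worst : ∃ λ (T : Tableau Λ) → ∀ {c d} →
    StrictTotalOrder._<_ ℕ³-descending (reach c , col c , row c) (reach d , col d , row d) → entry T c Fin.< entry T d
  worst = rank ℕ³-descending (λ c → reach c , col c , row c) (enumerate (parts Λ) cell)
    (length-enumerate (parts Λ) cell)
    (enumerate-unique (parts Λ) cell cell-injective)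
    (λ c → ∈-enumerate⁺ (parts Λ) cell (row c) (col c) (inside c))

proposition3p1 : (Λ : Partition) → IsWorstCaseComplexity Λ (sum (map w (cells Λ)))
proposition3p1 Λ = (T , attained) , bounded
  where
  T = proj₁ (worst {Λ})

  attained : exchanges {Λ} T ≡ sum (map w (cells Λ))
  attained = trans
    (rounds-exact {Λ} T (λ r< → proj₂ (worst {Λ}) (inj₁ r<)) (λ r≡ c≺d → proj₂ (worst {Λ}) (inj₂ (r≡ , c≺d)))
      (reverse (cells Λ)) T 0 (cells-decreasing {Λ}) (All.universal (λ _ → refl) _)
      -- At the start every cell awaits its round, and the grading holds because every entry is in
      -- its initial cell.
      (λ p → inj₁ (∈-resp-↭ (↭-sym (↭-reverse (cells Λ))) (∈-cells p)))
      (λ p → cong reach (locate-entry T refl)))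
    (sum-w-reverse {Λ})

  bounded : ∀ T → exchanges {Λ} T ℕ.≤ sum (map w (cells Λ))
  bounded T = subst (exchanges {Λ} T ℕ.≤_) (sum-w-reverse {Λ})
    (rounds-bounded {Λ} T (reverse (cells Λ)) T 0 (cells-decreasing {Λ}) (All.universal (λ _ → refl) _))
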